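{- Let $p\ge 2$ be an integer and let $\mathbf{c}=(c_n)_{n\ge 0}$ be a sequence with values in $\{ -1,1\}$. Let $(F_n(x))_{n\ge 0}$ be a sequence of polynomials in $\mathbb{Z}[x]$, with arbitrary $F_0(x),F_1(x)\in\mathbb{Z}[x]$, satisfying for all $n\ge 2$ $$F_n(x)=F_{n-1}(x)+c_n\,x\,F_{n-2}(x),$$ and write $F_n(x)=\sum_{i\ge 0}a_{n,i}x^i$ with $a_{n,i}\in\mathbb{Z}$ for all $n\ge 0$. If the sequence $\mathbf{c}$ is $p$-automatic, then for every $i\ge 0$ and every integer $m\ge 2$, the sequence $(a_{n,i}\bmod m)_{n\ge 0}$ is $p$-automatic.
   Context: For an integer $k\ge2$, a sequence $(u_n)_{n\ge0}$ with values in a finite set is $k$-automatic if its $k$-kernel $\{(u_{k^in+j})_{n\ge0} : i\ge 0,\ 0\le j<k^i\}$ is a finite set. -}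

module Defs where

open import Data.Nat.Base as ℕ using (ℕ; zero; suc; _<_; _^_)
open import Data.Integer.Base as ℤ using (ℤ; 0ℤ; 1ℤ)
open import Data.List.Base using (List; []; _∷_; map)
open import Data.Product.Base using (∃; _×_)
open import Function.Bundles using (_⇔_)
open import Level using (Level; _⊔_)
open import Relation.Binary.Bundles using (Setoid)
open import Relation.Binary.PropositionalEquality using (_≗_; _→-setoid_)
open import Relation.Unary using (Pred)
import Data.List.Membership.Propositional as Propositional
import Data.List.Membership.Setoid as SetoidMembership

private
  variable
    a ℓ p : Level

-- A subset P of a setoid is finite if P = {x₁ , … , xᵣ} for some list of
-- elements; repetitions are allowed, since equality need not be decidable.
IsFiniteSubset : (S : Setoid a ℓ) → Pred (Setoid.Carrier S) p → Set (a ⊔ ℓ ⊔ p)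
IsFiniteSubset S P = ∃ λ xs → ∀ x → P x ⇔ x ∈ xs
  where open SetoidMembership S using (_∈_)

-- Sequences are compared pointwise, as functions on ℕ.
Kernel : {A : Set a} → ℕ → (ℕ → A) → Pred (ℕ → A) a
Kernel k u v =
  ∃ λ i → ∃ λ j → j < k ^ i × v ≗ (λ n → u (k ^ i ℕ.* n ℕ.+ j))

HasFinitelyManyValues : {A : Set a} → (ℕ → A) → Set a
HasFinitelyManyValues u = ∃ λ xs → ∀ n → u n ∈ xs
  where open Propositional using (_∈_)

record IsAutomatic {A : Set a} (k : ℕ) (u : ℕ → A) : Set a where
  field
    finiteValues : HasFinitelyManyValues u
    finiteKernel : IsFiniteSubset (ℕ →-setoid A) (Kernel k u)

-- ℤ[x]: the list a₀ ∷ a₁ ∷ … ∷ [] is the polynomial a₀ + a₁ x + ….  Trailing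
-- zeros are allowed, so equality of polynomials is _≈ₚ_ and not _≡_.
Poly : Set
Poly = List ℤ

coeff : Poly → ℕ → ℤ
coeff []      _       = 0ℤ
coeff (a ∷ _) zero    = a
coeff (_ ∷ f) (suc i) = coeff f i

infix  4 _≈ₚ_
infixl 6 _+ₚ_
infixl 7 _*ₚ_

_≈ₚ_ : Poly → Poly → Set
f ≈ₚ g = coeff f ≗ coeff g

_+ₚ_ : Poly → Poly → Poly
[]      +ₚ g       = g
(a ∷ f) +ₚ []      = a ∷ f
(a ∷ f) +ₚ (b ∷ g) = (a ℤ.+ b) ∷ (f +ₚ g)

-- (a + x f) g = a g + x (f g)
_*ₚ_ : Poly → Poly → Poly
[]      *ₚ g = []
(a ∷ f) *ₚ g = map (a ℤ.*_) g +ₚ (0ℤ ∷ (f *ₚ g))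

const : ℤ → Poly
const a = a ∷ []

X : Poly
X = 0ℤ ∷ 1ℤ ∷ []

{-# OPTIONS --safe #-}
module Submission where

-- Call an integer sequence regular if it lies in a finitely generated ℤ-module
-- of sequences stable under all decimations n ↦ p n + r.  Automatic sequences
-- are regular, and regular sequences are closed under sums, products,
-- prepending a term and partial sums.  The recurrence exhibits (aₙ,ᵢ)ₙ as the
-- partial sums of c times a shift of (aₙ,ᵢ₋₁)ₙ, so it is regular by induction on
-- i.  Modulo m the module has finitely many elements, given by the combinations
-- of the generators with coefficients in {0, …, m − 1}.  They are the states of
-- a finite automaton with the decimations as transitions, and the kernel
-- consists of the states reachable from the sequence.

open import Defs
open import Data.Nat.Base using (ℕ; _+_; _≤_; NonZero)
open import Data.Integer.Base using (ℤ; 1ℤ; -1ℤ; _%ℕ_)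
open import Data.Sum.Base using (_⊎_)
open import Relation.Binary.PropositionalEquality using (_≡_)

open import Data.Fin.Base using (Fin; toℕ; fromℕ<)
open import Data.Fin.Properties using (any?; toℕ<n; toℕ-fromℕ<)
open import Data.Fin.Subset as Subset using (Subset; ⁅_⁆; _∪_; _⊃_)
open import Data.Fin.Subset.Induction using (Acc; acc; ⊃-wellFounded)
open import Data.Fin.Subset.Properties
  using (_∈?_; x∈⁅x⁆; x∈⁅y⁆⇒x≡y; x∈p∪q⁺; x∈p∪q⁻; p⊆p∪q)
open import Data.Integer.Base as ℤ using (0ℤ; +_; _-_; ∣_∣)
open import Data.Integer.DivMod using (_/ℕ_; n%ℕd<d; a≡a%ℕn+[a/ℕn]*n)
open import Data.Integer.Properties as ℤ using ()
open import Data.Integer.Tactic.RingSolver using (solve-∀)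
open import Data.List.Base
  using (List; []; _∷_; _++_; map; filter; allFin; upTo; length; lookup; cartesianProductWith)
open import Data.List.Membership.Propositional using (_∈_; find)
open import Data.List.Membership.Propositional.Properties
  using ( ∈-map⁺; ∈-map⁻; ∈-++⁺ˡ; ∈-++⁺ʳ; ∈-++⁻; ∈-filter⁺; ∈-filter⁻; ∈-allFin; ∈-lookup
        ; ∈-upTo⁺; ∈-cartesianProductWith⁺; ∈-cartesianProductWith⁻)
open import Data.List.Relation.Unary.Any as Any using (here; there)
open import Data.List.Relation.Unary.Any.Properties using (lookup-index)
open import Data.Nat.Base as ℕ using (zero; suc; _<_; _*_; _^_; z≤n; s≤s)
open import Data.Nat.Divisibility using (_∣_; divides; ∣⇒≤)
open import Data.Nat.DivMod using (_/_; _%_; m≡m%n+[m/n]*n; m%n<n; m<n*o⇒m/o<n)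
open import Data.Nat.Properties as ℕ using ()
open import Data.Nat.Tactic.RingSolver as ℕ-Ring using ()
open import Data.Product.Base using (∃; ∃₂; _×_; _,_; proj₁; proj₂)
open import Data.Sum.Base using (inj₁; inj₂)
open import Function.Base using (id; _∘_)
open import Function.Bundles using (mk⇔; Equivalence)
open import Level using (Level)
open import Relation.Binary.PropositionalEquality
  using (_≗_; _→-setoid_; refl; sym; trans; cong; cong₂; subst; module ≡-Reasoning)
open import Relation.Nullary.Decidable using (yes; no; ¬?; _×-dec_; decidable-stable)
open import Relation.Nullary.Negation using (contradiction)

private
  variable
    a ℓ : Level
    A : Set a
    p : ℕ

-- Kernels and decimations.

decimate : ℕ → ℕ → (ℕ → A) → ℕ → A
decimate p r f n = f (p * n + r)

n≡1*n+0 : ∀ n → n ≡ 1 * n + 0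
n≡1*n+0 = ℕ-Ring.solve-∀

kernel-self : (u : ℕ → A) → Kernel p u u
kernel-self u = 0 , 0 , s≤s z≤n , λ n → cong u (n≡1*n+0 n)

digits-< : ∀ {k b j r} → j < b → r < k → b * r + j < k * b
digits-< {k} {b} {j} {r} j<b r<k = begin-strict
  b * r + j     <⟨ ℕ.+-monoʳ-< (b * r) j<b ⟩
  b * r + b     ≡⟨ ℕ.+-comm (b * r) b ⟩
  b + b * r     ≡⟨ ℕ.*-suc b r ⟨
  b * suc r     ≤⟨ ℕ.*-monoʳ-≤ b r<k ⟩
  b * k         ≡⟨ ℕ.*-comm b k ⟩
  k * b         ∎
  where open ℕ.≤-Reasoning

kernel-decimate : (u : ℕ → A) {v : ℕ → A} → Kernel p u v → ∀ {r} → r < p → Kernel p u (decimate p r v)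
kernel-decimate {p = p} u (i , j , j<pⁱ , v≗) {r} r<p =
  suc i , p ^ i * r + j , digits-< j<pⁱ r<p ,
  λ n → trans (v≗ (p * n + r)) (cong u (lemma p (p ^ i) n r j))
  where
  lemma : ∀ p b n r j → b * (p * n + r) + j ≡ p * b * n + (b * r + j)
  lemma = ℕ-Ring.solve-∀

-- Induction on `i`, peeling off the leading base-`p` digit of `j`: if `j = q p^i + s` with
-- `s < p^i`, the kernel element for `(suc i , j)` is the decimation by `q` of the one for
-- `(i , s)`.
kernel-induction : .{{_ : NonZero p}} {u : ℕ → A} (Q : (ℕ → A) → Set ℓ) →
  (∀ {v w} → v ≗ w → Q v → Q w) → Q u → (∀ {v r} → r < p → Q v → Q (decimate p r v)) →
  ∀ {v} → Kernel p u v → Q v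
kernel-induction {p = p} {u = u} Q Q-resp Qu Q-decimate (i , j , j<pⁱ , v≗) =
  Q-resp (sym ∘ v≗) (go i j j<pⁱ)
  where
  go : ∀ i j → j < p ^ i → Q (λ n → u (p ^ i * n + j))
  go zero    zero (s≤s z≤n) = Q-resp (cong u ∘ n≡1*n+0) Qu
  go (suc i) j j<pⁱ⁺¹ = Q-resp (cong u ∘ eq) (Q-decimate q<p (go i (j % b) (m%n<n j b)))
    where
    b = p ^ i
    instance
      b≢0 : NonZero b
      b≢0 = ℕ.m^n≢0 p i
    q = j / b
    q<p : q < p
    q<p = m<n*o⇒m/o<n j<pⁱ⁺¹
    lemma : ∀ p b n q s → b * (p * n + q) + s ≡ p * b * n + (s + q * b)
    lemma = ℕ-Ring.solve-∀
    eq : ∀ n → b * (p * n + q) + j % b ≡ p * b * n + j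
    eq n = trans (lemma p b n q (j % b)) (cong (_+_ (p * b * n)) (sym (m≡m%n+[m/n]*n j b)))

-- Reachable states and finiteness of the kernel.

module _ {N} (δ : Fin N → Fin p → Fin N) (P : Fin N → Set ℓ)
         (P-δ : ∀ {s} r → P s → P (δ s r)) {s₀} (P-s₀ : P s₀) where

  open Subset using () renaming (_∈_ to _∈ₛ_; _∉_ to _∉ₛ_)

  -- Minimality of `S` is replaced by two bounds: closure under `δ` forces every reachable state
  -- into `S`, and `P` bounds `S` from above.
  Reachable : Set ℓ
  Reachable = ∃ λ S → s₀ ∈ₛ S × (∀ {s} r → s ∈ₛ S → δ s r ∈ₛ S) × (∀ {s} → s ∈ₛ S → P s)

  reachable : Reachable
  reachable = grow ⁅ s₀ ⁆ (⊃-wellFounded _) (x∈⁅x⁆ s₀) λ s∈ →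
              subst P (sym (x∈⁅y⁆⇒x≡y s₀ s∈)) P-s₀
    where
    grow : (S : Subset N) → Acc _⊃_ S → s₀ ∈ₛ S → (∀ {s} → s ∈ₛ S → P s) → Reachable
    grow S (acc rec) s₀∈S P-S
      -- Search for a transition leaving `S`. If there is one, its target is added; subsets of
      -- `Fin N` grow strictly only finitely often.
      with any? (λ s → s ∈? S ×-dec any? (λ r → ¬? (δ s r ∈? S)))
    ... | no closed = S , s₀∈S ,
          (λ {s} r s∈S → decidable-stable (δ s r ∈? S) λ ∉S → closed (s , s∈S , r , ∉S)) , P-S
    ... | yes (s , s∈S , r , ∉S) =
          grow (S ∪ ⁅ t ⁆)
            (rec (p⊆p∪q ⁅ t ⁆ , t , x∈p∪q⁺ (inj₂ (x∈⁅x⁆ t)) , ∉S))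
            (p⊆p∪q ⁅ t ⁆ s₀∈S)
            (λ x∈ → P-S∪t (x∈p∪q⁻ S ⁅ t ⁆ x∈))
      where
      t = δ s r
      P-S∪t : ∀ {x} → x ∈ₛ S ⊎ x ∈ₛ ⁅ t ⁆ → P x
      P-S∪t (inj₁ x∈S) = P-S x∈S
      P-S∪t (inj₂ x∈t) = subst P (sym (x∈⁅y⁆⇒x≡y t x∈t)) (P-δ r (P-S s∈S))

-- The list may contain kernel elements only, but no decision procedure for `Kernel p u (w s)` is
-- given. Filtering therefore uses the decidable set `S` of reachable states, obtained with `P s`
-- chosen as `Kernel p u (w s)`.
finite-kernel : .{{_ : NonZero p}} {A : Set a} {N : ℕ} {u : ℕ → A} (w : Fin N → ℕ → A)
  (δ : Fin N → Fin p → Fin N) → (∀ s r → decimate p (toℕ r) (w s) ≗ w (δ s r)) →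
  ∀ s₀ → u ≗ w s₀ → IsFiniteSubset (ℕ →-setoid A) (Kernel p u)
finite-kernel {p = p} {N = N} {u = u} w δ w-δ s₀ u≗ =
  map w (filter (_∈? S) (allFin N)) , λ v → mk⇔ (to v) (from v)
  where
  kernel-resp : ∀ {v v′} → v ≗ v′ → Kernel p u v → Kernel p u v′
  kernel-resp v≗v′ (i , j , j< , v≗) = i , j , j< , λ n → trans (sym (v≗v′ n)) (v≗ n)

  states = reachable δ (λ s → Kernel p u (w s))
    (λ {s} r k → kernel-resp (w-δ s r) (kernel-decimate u k (toℕ<n r)))
    (kernel-resp u≗ (kernel-self u))
  S = proj₁ states
  s₀∈S = proj₁ (proj₂ states)
  δ-S = proj₁ (proj₂ (proj₂ states))
  kernel-S = proj₂ (proj₂ (proj₂ states))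

  Attained : (ℕ → _) → Set _
  Attained v = ∃ λ s → s Subset.∈ S × v ≗ w s

  attained : ∀ {v} → Kernel p u v → Attained v
  attained = kernel-induction Attained
    (λ v≗v′ (s , s∈S , v≗) → s , s∈S , λ n → trans (sym (v≗v′ n)) (v≗ n))
    (s₀ , s₀∈S , u≗)
    λ { {r = r} r<p (s , s∈S , v≗) → δ s (fromℕ< r<p) , δ-S _ s∈S , λ n →
          trans (v≗ (p * n + r))
            (trans (cong (λ r → w s (p * n + r)) (sym (toℕ-fromℕ< r<p)))
              (w-δ s (fromℕ< r<p) n)) }

  to : ∀ v → Kernel p u v → Any.Any (v ≗_) (map w (filter (_∈? S) (allFin N)))
  to v k with s , s∈S , v≗ ← attained k =
    Any.map (λ { refl → v≗ }) (∈-map⁺ w (∈-filter⁺ (_∈? S) (∈-allFin s) s∈S))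

  from : ∀ v → Any.Any (v ≗_) (map w (filter (_∈? S) (allFin N))) → Kernel p u v
  from v v∈ with find v∈
  ... | _ , x∈ , v≗ with ∈-map⁻ w x∈
  ... | s , s∈ , refl =
    kernel-resp (sym ∘ v≗) (kernel-S (proj₂ (∈-filter⁻ (_∈? S) {xs = allFin N} s∈)))

-- Spans of integer sequences and linear operators.

Sequence : Set
Sequence = ℕ → ℤ

infixl 6 _⊕_
infixl 7 _⊙_ _⊛_

_⊕_ _⊙_ : Sequence → Sequence → Sequence
(f ⊕ g) n = f n ℤ.+ g n
(f ⊙ g) n = f n ℤ.* g n

_⊛_ : ℤ → Sequence → Sequence
(a ⊛ f) n = a ℤ.* f n

0ₛ : Sequence
0ₛ _ = 0ℤ

-- The generated ℤ-module; `resp` stands in for function extensionality.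
data Span (xs : List Sequence) : Sequence → Set where
  gen   : ∀ {f} → f ∈ xs → Span xs f
  resp  : ∀ {f g} → f ≗ g → Span xs f → Span xs g
  zeroₛ : Span xs 0ₛ
  add   : ∀ {f g} → Span xs f → Span xs g → Span xs (f ⊕ g)
  scale : ∀ a {f} → Span xs f → Span xs (a ⊛ f)

record IsLinear (T : Sequence → Sequence) : Set where
  field
    cong-≗ : ∀ {f g} → f ≗ g → T f ≗ T g
    homo-⊕ : ∀ f g → T (f ⊕ g) ≗ T f ⊕ T g
    homo-⊛ : ∀ a f → T (a ⊛ f) ≗ a ⊛ T f

open IsLinear

span-map : ∀ {T xs ys} → IsLinear T → (∀ {g} → g ∈ xs → Span ys (T g)) →
  ∀ {f} → Span xs f → Span ys (T f)
span-map lin h (gen g∈)    = h g∈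
span-map lin h (resp e s)  = resp (cong-≗ lin e) (span-map lin h s)
-- `0ℤ ⊛ 0ₛ` computes to `0ₛ`, so homogeneity with scalar `0ℤ` shows that `T` sends zero to zero.
span-map lin h zeroₛ       = resp (sym ∘ homo-⊛ lin 0ℤ 0ₛ) zeroₛ
span-map lin h (add s t)   =
  resp (sym ∘ homo-⊕ lin _ _) (add (span-map lin h s) (span-map lin h t))
span-map lin h (scale a s) = resp (sym ∘ homo-⊛ lin a _) (scale a (span-map lin h s))

linear-id : IsLinear id
linear-id .cong-≗ e = e
linear-id .homo-⊕ f g n = refl
linear-id .homo-⊛ a f n = refl

linear-decimate : ∀ r → IsLinear (decimate p r)
linear-decimate r .cong-≗ e n = e _
linear-decimate r .homo-⊕ f g n = refl
linear-decimate r .homo-⊛ a f n = refl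

linear-⊙ˡ : ∀ h → IsLinear (h ⊙_)
linear-⊙ˡ h .cong-≗ e n = cong (h n ℤ.*_) (e n)
linear-⊙ˡ h .homo-⊕ f g n = ℤ.*-distribˡ-+ (h n) (f n) (g n)
linear-⊙ˡ h .homo-⊛ a f n = lemma (h n) a (f n)
  where
  lemma : ∀ x a y → x ℤ.* (a ℤ.* y) ≡ a ℤ.* (x ℤ.* y)
  lemma = solve-∀

linear-⊙ʳ : ∀ h → IsLinear (_⊙ h)
linear-⊙ʳ h .cong-≗ e n = cong (ℤ._* h n) (e n)
linear-⊙ʳ h .homo-⊕ f g n = ℤ.*-distribʳ-+ (h n) (f n) (g n)
linear-⊙ʳ h .homo-⊛ a f n = ℤ.*-assoc a (f n) (h n)

span-⊆ : ∀ {xs ys} → (∀ {g} → g ∈ xs → g ∈ ys) → ∀ {f} → Span xs f → Span ys f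
span-⊆ xs⊆ys = span-map linear-id (gen ∘ xs⊆ys)

-- Bilinearity: first expand the left factor with `g` fixed, then the right factor for each
-- generator on the left.
span-⊙ : ∀ {xs ys f g} → Span xs f → Span ys g → Span (cartesianProductWith _⊙_ xs ys) (f ⊙ g)
span-⊙ {g = g} s t = span-map (linear-⊙ʳ g)
  (λ {f′} f′∈ → span-map (linear-⊙ˡ f′) (λ g′∈ → gen (∈-cartesianProductWith⁺ _⊙_ f′∈ g′∈)) t) s

-- Regular sequences and their closure properties.

-- These are the `p`-regular sequences of Allouche and Shallit over ℤ. Closure is asked of the
-- generators; linearity of decimation extends it to the span.
record IsRegular (p : ℕ) (f : Sequence) : Set where
  field
    generators : List Sequence
    closed     : ∀ {g} → g ∈ generators → ∀ {r} → r < p → Span generators (decimate p r g)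
    spanned    : Span generators f

open IsRegular

regular-resp : ∀ {f g} → f ≗ g → IsRegular p f → IsRegular p g
regular-resp f≗g reg = record
  { generators = generators reg ; closed = closed reg ; spanned = resp f≗g (spanned reg) }

regular-0ₛ : IsRegular p 0ₛ
regular-0ₛ = record { generators = [] ; closed = λ () ; spanned = zeroₛ }

-- The kernel elements serve as generators, since decimation maps the kernel into itself.
automatic⇒regular : ∀ {f} → IsAutomatic p f → IsRegular p f
automatic⇒regular {p = p} {f} aut = record
  { generators = xs
  ; closed     = λ {g} g∈xs r<p → kernel⇒span
      (kernel-decimate f (Equivalence.from (proj₂ finiteKernel g) (Any.map (λ { refl _ → refl }) g∈xs)) r<p)
  ; spanned    = kernel⇒span (kernel-self f)
  }
  where
  open IsAutomatic aut
  xs = proj₁ finiteKernel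
  kernel⇒span : ∀ {g} → Kernel p f g → Span xs g
  kernel⇒span {g} k with find (Equivalence.to (proj₂ finiteKernel g) k)
  ... | _ , h∈xs , g≗h = resp (sym ∘ g≗h) (gen h∈xs)

regular-⊕ : ∀ {f g} → IsRegular p f → IsRegular p g → IsRegular p (f ⊕ g)
regular-⊕ {p = p} F G = record
  { generators = xs ++ ys
  ; closed     = λ h∈ → closed′ (∈-++⁻ xs h∈)
  ; spanned    = add (span-⊆ ∈-++⁺ˡ (spanned F)) (span-⊆ (∈-++⁺ʳ xs) (spanned G))
  }
  where
  xs = generators F
  ys = generators G
  closed′ : ∀ {h} → h ∈ xs ⊎ h ∈ ys → ∀ {r} → r < p → Span (xs ++ ys) (decimate p r h)
  closed′ (inj₁ h∈) r<p = span-⊆ ∈-++⁺ˡ (closed F h∈ r<p)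
  closed′ (inj₂ h∈) r<p = span-⊆ (∈-++⁺ʳ xs) (closed G h∈ r<p)

-- Decimation commutes definitionally with pointwise products, so a product of generators decimates
-- to a product of elements of the two spans.
regular-⊙ : ∀ {f g} → IsRegular p f → IsRegular p g → IsRegular p (f ⊙ g)
regular-⊙ {p = p} F G = record
  { generators = zs
  ; closed     = closed′
  ; spanned    = span-⊙ (spanned F) (spanned G)
  }
  where
  xs = generators F
  ys = generators G
  zs = cartesianProductWith _⊙_ xs ys
  closed′ : ∀ {h} → h ∈ zs → ∀ {r} → r < p → Span zs (decimate p r h)
  closed′ h∈ r<p with ∈-cartesianProductWith⁻ _⊙_ xs ys h∈
  ... | _ , _ , x∈ , y∈ , refl = span-⊙ (closed F x∈ r<p) (closed G y∈ r<p)

cons : ℤ → Sequence → Sequence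
cons a f zero    = a
cons a f (suc n) = f n

linear-cons-0 : IsLinear (cons 0ℤ)
linear-cons-0 .cong-≗ e zero    = refl
linear-cons-0 .cong-≗ e (suc n) = e n
linear-cons-0 .homo-⊕ f g zero    = refl
linear-cons-0 .homo-⊕ f g (suc n) = refl
linear-cons-0 .homo-⊛ a f zero    = sym (ℤ.*-zeroʳ a)
linear-cons-0 .homo-⊛ a f (suc n) = refl

-- With `p = suc q`, index `p (n + 1)` after prepending is index `p n + q` of `f`.
decimate-0-cons : ∀ q a f → decimate (suc q) 0 (cons a f) ≗ cons a (decimate (suc q) q f)
decimate-0-cons q a f zero rewrite ℕ.*-zeroʳ q = refl
decimate-0-cons q a f (suc n) = cong (cons a f) (lemma q n)
  where
  lemma : ∀ q n → suc q * suc n + 0 ≡ suc (suc q * n + q)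
  lemma = ℕ-Ring.solve-∀

decimate-suc-cons : ∀ p r a f → decimate p (suc r) (cons a f) ≗ decimate p r f
decimate-suc-cons p r a f n = cong (cons a f) (ℕ.+-suc (p * n) r)

regular-cons : .{{_ : NonZero p}} → ∀ a {f} → IsRegular p f → IsRegular p (cons a f)
regular-cons {p = p@(suc q)} a {f} F = record
  { generators = zs
  ; closed     = closed′
  ; spanned    = resp eq (add (scale a (gen (here refl))) (span-cons (spanned F)))
  }
  where
  xs = generators F
  ys = map (cons 0ℤ) xs
  -- The indicator of index 0 carries the prepended value. Decimation by 0 keeps a sequence shifted
  -- and every other decimation undoes the shift, so both shifted and original generators are
  -- present.
  zs = cons 1ℤ 0ₛ ∷ ys ++ xs
  span-cons : ∀ {g} → Span xs g → Span zs (cons 0ℤ g)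
  span-cons = span-map linear-cons-0 λ g∈ → gen (there (∈-++⁺ˡ (∈-map⁺ _ g∈)))
  span-xs : ∀ {g} → Span xs g → Span zs g
  span-xs = span-⊆ (there ∘ ∈-++⁺ʳ ys)
  closed-cons : ∀ b {g} → Span zs (cons b (decimate p q g)) → (∀ {r} → r < p → Span zs (decimate p r g)) →
    ∀ {r} → r < p → Span zs (decimate p r (cons b g))
  closed-cons b {g} s t {zero}  _    = resp (sym ∘ decimate-0-cons q b g) s
  closed-cons b {g} s t {suc r} r<p  = resp (sym ∘ decimate-suc-cons p r b g) (t (ℕ.<-trans (ℕ.n<1+n r) r<p))
  closed′ : ∀ {h} → h ∈ zs → ∀ {r} → r < p → Span zs (decimate p r h)
  closed′ (here refl) = closed-cons 1ℤ (gen (here refl)) (λ _ → zeroₛ)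
  closed′ (there h∈) with ∈-++⁻ ys h∈
  ... | inj₂ h∈xs = span-xs ∘ closed F h∈xs
  ... | inj₁ h∈ys with ∈-map⁻ (cons 0ℤ) h∈ys
  ... | g , g∈ , refl =
    closed-cons 0ℤ (span-cons (closed F g∈ (ℕ.n<1+n q))) (span-xs ∘ closed F g∈)
  eq : a ⊛ cons 1ℤ 0ₛ ⊕ cons 0ℤ f ≗ cons a f
  eq zero    = trans (ℤ.+-identityʳ _) (ℤ.*-identityʳ a)
  eq (suc n) = trans (cong (ℤ._+ f n) (ℤ.*-zeroʳ a)) (ℤ.+-identityˡ (f n))

Σ< : Sequence → Sequence
Σ< f zero    = 0ℤ
Σ< f (suc n) = Σ< f n ℤ.+ f n

linear-Σ< : IsLinear Σ<
linear-Σ< .cong-≗ e zero    = refl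
linear-Σ< .cong-≗ e (suc n) = cong₂ ℤ._+_ (linear-Σ< .cong-≗ e n) (e n)
linear-Σ< .homo-⊕ f g zero    = refl
linear-Σ< .homo-⊕ f g (suc n) =
  trans (cong (ℤ._+ (f n ℤ.+ g n)) (linear-Σ< .homo-⊕ f g n)) (lemma (Σ< f n) (Σ< g n) (f n) (g n))
  where
  lemma : ∀ w x y z → (w ℤ.+ x) ℤ.+ (y ℤ.+ z) ≡ (w ℤ.+ y) ℤ.+ (x ℤ.+ z)
  lemma = solve-∀
linear-Σ< .homo-⊛ a f zero    = sym (ℤ.*-zeroʳ a)
linear-Σ< .homo-⊛ a f (suc n) =
  trans (cong (ℤ._+ a ℤ.* f n) (linear-Σ< .homo-⊛ a f n)) (sym (ℤ.*-distribˡ-+ a (Σ< f n) (f n)))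

Σ<-+ : ∀ f m k → Σ< f (m + k) ≡ Σ< f m ℤ.+ Σ< (λ t → f (m + t)) k
Σ<-+ f m zero rewrite ℕ.+-identityʳ m = sym (ℤ.+-identityʳ _)
Σ<-+ f m (suc k) rewrite ℕ.+-suc m k | Σ<-+ f m k = ℤ.+-assoc (Σ< f m) _ _

blockΣ : ℕ → Sequence → ℕ → Sequence
blockΣ p f k n = Σ< (λ t → f (p * n + t)) k

Σ<-* : ∀ p f n → Σ< f (p * n) ≡ Σ< (blockΣ p f p) n
Σ<-* p f zero rewrite ℕ.*-zeroʳ p = refl
Σ<-* p f (suc n) = begin
  Σ< f (p * suc n)                              ≡⟨ cong (Σ< f) (trans (ℕ.*-suc p n) (ℕ.+-comm p (p * n))) ⟩
  Σ< f (p * n + p)                              ≡⟨ Σ<-+ f (p * n) p ⟩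
  Σ< f (p * n) ℤ.+ blockΣ p f p n               ≡⟨ cong (ℤ._+ blockΣ p f p n) (Σ<-* p f n) ⟩
  Σ< (blockΣ p f p) n ℤ.+ blockΣ p f p n        ∎
  where open ≡-Reasoning

-- The first `p n + r` terms form `n` full blocks of length `p` and the first `r` terms of the next
-- block.
decimate-Σ< : ∀ p r f → decimate p r (Σ< f) ≗ Σ< (blockΣ p f p) ⊕ blockΣ p f r
decimate-Σ< p r f n = trans (Σ<-+ f (p * n) r) (cong (ℤ._+ blockΣ p f r n) (Σ<-* p f n))

-- As a sequence in `n`, the block sum is the sum of the decimations of `f` with remainders below
-- `k`.
span-blockΣ : ∀ {xs} f → (∀ {r} → r < p → Span xs (decimate p r f)) → ∀ {k} → k ≤ p → Span xs (blockΣ p f k)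
span-blockΣ f h {zero}  _   = zeroₛ
span-blockΣ f h {suc k} k<p = add (span-blockΣ f h (ℕ.<⇒≤ k<p)) (h k<p)

-- By `decimate-Σ<`, a decimation of `Σ< g` is the partial sum of an element of the span plus an
-- element of the span, so generators and their partial sums together suffice.
regular-Σ< : ∀ {f} → IsRegular p f → IsRegular p (Σ< f)
regular-Σ< {p = p} {f} F = record
  { generators = zs
  ; closed     = λ h∈ → closed′ (∈-++⁻ ys h∈)
  ; spanned    = span-Σ< (spanned F)
  }
  where
  xs = generators F
  ys = map Σ< xs
  zs = ys ++ xs
  span-Σ< : ∀ {g} → Span xs g → Span zs (Σ< g)
  span-Σ< = span-map linear-Σ< λ g∈ → gen (∈-++⁺ˡ (∈-map⁺ _ g∈))
  span-xs : ∀ {g} → Span xs g → Span zs g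
  span-xs = span-⊆ (∈-++⁺ʳ ys)
  closed′ : ∀ {h} → h ∈ ys ⊎ h ∈ xs → ∀ {r} → r < p → Span zs (decimate p r h)
  closed′ (inj₂ h∈xs) = span-xs ∘ closed F h∈xs
  closed′ (inj₁ h∈ys) {r} r<p with ∈-map⁻ Σ< h∈ys
  ... | g , g∈ , refl = resp (sym ∘ decimate-Σ< p r g)
    (add (span-Σ< (span-blockΣ g (closed F g∈) ℕ.≤-refl))
         (span-xs (span-blockΣ g (closed F g∈) (ℕ.<⇒≤ r<p))))

-- Reduction modulo `m`.

span-decimate : ∀ {xs} → (∀ {g} → g ∈ xs → ∀ {r} → r < p → Span xs (decimate p r g)) →
  ∀ {f} → Span xs f → ∀ {r} → r < p → Span xs (decimate p r f)
span-decimate {p = p} h s {r} r<p = span-map (linear-decimate {p = p} r) (λ g∈ → h g∈ r<p) s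

span-[] : ∀ {f} → Span [] f → f ≗ 0ₛ
span-[] (resp e s) n = trans (sym (e n)) (span-[] s n)
span-[] zeroₛ n = refl
span-[] (add s t) n = cong₂ ℤ._+_ (span-[] s n) (span-[] t n)
span-[] (scale a s) n = trans (cong (a ℤ.*_) (span-[] s n)) (ℤ.*-zeroʳ a)

-- Exposes the coefficient of one generator, so that it can be reduced modulo `m`.
span-∷ : ∀ {g xs f} → Span (g ∷ xs) f → ∃₂ λ a h → Span xs h × f ≗ a ⊛ g ⊕ h
span-∷ {g} (gen (here refl)) = 1ℤ , 0ₛ , zeroₛ , λ n → lemma (g n)
  where
  lemma : ∀ x → x ≡ 1ℤ ℤ.* x ℤ.+ 0ℤ
  lemma = solve-∀
span-∷ {g} {f = f} (gen (there f∈)) = 0ℤ , f , gen f∈ , λ n → sym (ℤ.+-identityˡ (f n))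
span-∷ (resp e s) with a , h , t , eq ← span-∷ s = a , h , t , λ n → trans (sym (e n)) (eq n)
span-∷ {g} zeroₛ = 0ℤ , 0ₛ , zeroₛ , λ n → refl
span-∷ {g} (add s t) with a , h , s′ , e ← span-∷ s | b , k , t′ , e′ ← span-∷ t =
  a ℤ.+ b , h ⊕ k , add s′ t′ , λ n → trans (cong₂ ℤ._+_ (e n) (e′ n)) (lemma a b (g n) (h n) (k n))
  where
  lemma : ∀ a b x y z → (a ℤ.* x ℤ.+ y) ℤ.+ (b ℤ.* x ℤ.+ z) ≡ (a ℤ.+ b) ℤ.* x ℤ.+ (y ℤ.+ z)
  lemma = solve-∀
span-∷ {g} (scale b s) with a , h , s′ , e ← span-∷ s =
  b ℤ.* a , b ⊛ h , scale b s′ , λ n → trans (cong (b ℤ.*_) (e n)) (lemma b a (g n) (h n))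
  where
  lemma : ∀ b a x y → b ℤ.* (a ℤ.* x ℤ.+ y) ≡ (b ℤ.* a) ℤ.* x ℤ.+ b ℤ.* y
  lemma = solve-∀

-- The difference of the remainders is a multiple of `m` of absolute value below `m`, hence zero.
%ℕ-cong : ∀ m .{{_ : NonZero m}} {a} b k → a ≡ b ℤ.+ k ℤ.* + m → a %ℕ m ≡ b %ℕ m
%ℕ-cong m {a} b k a≡b+km = ℤ.+-injective (ℤ.i-j≡0⇒i≡j (+ r) (+ s) (ℤ.∣i∣≡0⇒i≡0 ∣r-s∣≡0))
  where
  r = a %ℕ m
  s = b %ℕ m
  x = a /ℕ m
  y = b /ℕ m
  lemma₁ : ∀ r x m s → r - s ≡ (r ℤ.+ x ℤ.* m) - s - x ℤ.* m
  lemma₁ = solve-∀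
  lemma₂ : ∀ s y k m x → (s ℤ.+ y ℤ.* m) ℤ.+ k ℤ.* m - s - x ℤ.* m ≡ (y ℤ.+ k - x) ℤ.* m
  lemma₂ = solve-∀
  r-s≡ : + r - + s ≡ (y ℤ.+ k - x) ℤ.* + m
  r-s≡ = begin
    + r - + s                                               ≡⟨ lemma₁ (+ r) x (+ m) (+ s) ⟩
    (+ r ℤ.+ x ℤ.* + m) - + s - x ℤ.* + m                   ≡⟨ cong (λ z → z - + s - x ℤ.* + m) (sym (a≡a%ℕn+[a/ℕn]*n a m)) ⟩
    a - + s - x ℤ.* + m                                     ≡⟨ cong (λ z → z - + s - x ℤ.* + m) a≡b+km ⟩
    b ℤ.+ k ℤ.* + m - + s - x ℤ.* + m                       ≡⟨ cong (λ z → z ℤ.+ k ℤ.* + m - + s - x ℤ.* + m) (a≡a%ℕn+[a/ℕn]*n b m) ⟩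
    (+ s ℤ.+ y ℤ.* + m) ℤ.+ k ℤ.* + m - + s - x ℤ.* + m     ≡⟨ lemma₂ (+ s) y k (+ m) x ⟩
    (y ℤ.+ k - x) ℤ.* + m                                   ∎
    where open ≡-Reasoning
  m∣r-s : m ∣ ∣ + r - + s ∣
  m∣r-s = divides ∣ y ℤ.+ k - x ∣ (trans (cong ∣_∣ r-s≡) (ℤ.abs-* (y ℤ.+ k - x) (+ m)))
  ∣r-s∣<m : ∣ + r - + s ∣ < m
  ∣r-s∣<m = begin-strict
    ∣ + r - + s ∣   ≡⟨ cong ∣_∣ (ℤ.m-n≡m⊖n r s) ⟩
    ∣ r ℤ.⊖ s ∣     ≤⟨ ℤ.∣m⊝n∣≤m⊔n r s ⟩
    r ℕ.⊔ s         <⟨ ℕ.⊔-pres-<m (n%ℕd<d a m) (n%ℕd<d b m) ⟩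
    m               ∎
    where open ℕ.≤-Reasoning
  ∣r-s∣≡0 : ∣ + r - + s ∣ ≡ 0
  ∣r-s∣≡0 with ∣ + r - + s ∣ | m∣r-s | ∣r-s∣<m
  ... | zero  | _  | _  = refl
  ... | suc d | m∣ | <m = contradiction (∣⇒≤ m∣) (ℕ.<⇒≱ <m)

combinations : ℕ → List Sequence → List Sequence
combinations m []       = 0ₛ ∷ []
combinations m (g ∷ xs) = cartesianProductWith (λ j h → + j ⊛ g ⊕ h) (upTo m) (combinations m xs)

combinations-spanned : ∀ m xs {f} → f ∈ combinations m xs → Span xs f
combinations-spanned m []       (here refl) = zeroₛ
combinations-spanned m (g ∷ xs) f∈
  with j , h , _ , h∈ , refl ← ∈-cartesianProductWith⁻ (λ j h → + j ⊛ g ⊕ h) (upTo m) (combinations m xs) f∈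
  = add (scale (+ j) (gen (here refl))) (span-⊆ there (combinations-spanned m xs h∈))

-- Each coefficient `a` is replaced by `a %ℕ m`; the discarded part `(a /ℕ m) ℤ.* + m` contributes a
-- multiple of `m` at every `n`.
combinations-complete : ∀ m .{{_ : NonZero m}} xs {f} → Span xs f →
  ∃ λ h → h ∈ combinations m xs × (∀ n → ∃ λ k → f n ≡ h n ℤ.+ k ℤ.* + m)
combinations-complete m []       s = 0ₛ , here refl , λ n → 0ℤ , span-[] s n
combinations-complete m (g ∷ xs) s
  with a , f , t , e ← span-∷ s
  with h , h∈ , e′ ← combinations-complete m xs t
  = _ , ∈-cartesianProductWith⁺ (λ j h → + j ⊛ g ⊕ h) (∈-upTo⁺ (n%ℕd<d a m)) h∈ , λ n →
    proj₁ (e′ n) ℤ.+ (a /ℕ m) ℤ.* g n ,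
    trans (e n) (trans (cong₂ (λ a y → a ℤ.* g n ℤ.+ y) (a≡a%ℕn+[a/ℕn]*n a m) (proj₂ (e′ n)))
      (lemma (+ (a %ℕ m)) (a /ℕ m) (+ m) (g n) (h n) (proj₁ (e′ n))))
  where
  lemma : ∀ r q m x y k → (r ℤ.+ q ℤ.* m) ℤ.* x ℤ.+ (y ℤ.+ k ℤ.* m) ≡ (r ℤ.* x ℤ.+ y) ℤ.+ (k ℤ.+ q ℤ.* x) ℤ.* m
  lemma = solve-∀

regular⇒automatic-mod : .{{_ : NonZero p}} → ∀ {f} → IsRegular p f → ∀ m .{{_ : NonZero m}} →
  IsAutomatic p (λ n → f n %ℕ m)
regular⇒automatic-mod {p = p} {f} F m = record
  { finiteValues = upTo m , λ n → ∈-upTo⁺ (n%ℕd<d (f n) m)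
  ; finiteKernel = finite-kernel w (λ s r → proj₁ (step s r)) (λ s r → proj₂ (step s r))
                     (proj₁ start) (proj₂ start)
  }
  where
  xs = generators F
  cs = combinations m xs
  w : Fin (length cs) → ℕ → ℕ
  w s n = lookup cs s n %ℕ m
  state : ∀ {g} → Span xs g → ∃ λ s → (λ n → g n %ℕ m) ≗ w s
  state t with h , h∈ , e ← combinations-complete m xs t = Any.index h∈ , λ n →
    trans (%ℕ-cong m (h n) (proj₁ (e n)) (proj₂ (e n))) (cong (λ h → h n %ℕ m) (lookup-index h∈))
  -- Decimation commutes with reduction modulo `m`, so a transition decimates the integer sequence
  -- behind the state and then picks a combination congruent to the result. Distinct states may
  -- denote the same sequence.
  step : ∀ s (r : Fin p) → ∃ λ t → decimate p (toℕ r) (w s) ≗ w t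
  step s r = state (span-decimate (closed F) (combinations-spanned m xs (∈-lookup s)) (toℕ<n r))
  start = state (spanned F)

-- Coefficients of sums and of products with `a x`.

coeff-+ₚ : ∀ f g i → coeff (f +ₚ g) i ≡ coeff f i ℤ.+ coeff g i
coeff-+ₚ []      g       i       = sym (ℤ.+-identityˡ _)
coeff-+ₚ (a ∷ f) []      i       = sym (ℤ.+-identityʳ _)
coeff-+ₚ (a ∷ f) (b ∷ g) zero    = refl
coeff-+ₚ (a ∷ f) (b ∷ g) (suc i) = coeff-+ₚ f g i

coeff-map-* : ∀ a f i → coeff (map (a ℤ.*_) f) i ≡ a ℤ.* coeff f i
coeff-map-* a []      i       = sym (ℤ.*-zeroʳ a)
coeff-map-* a (b ∷ f) zero    = refl
coeff-map-* a (b ∷ f) (suc i) = coeff-map-* a f i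

coeff-0∷[] : ∀ i → coeff (0ℤ ∷ []) i ≡ 0ℤ
coeff-0∷[] zero    = refl
coeff-0∷[] (suc i) = refl

coeff-aX*ₚ-zero : ∀ a f → coeff (const a *ₚ X *ₚ f) 0 ≡ 0ℤ
coeff-aX*ₚ-zero a f = begin
  coeff (map (b ℤ.*_) f +ₚ (0ℤ ∷ g)) 0       ≡⟨ coeff-+ₚ (map (b ℤ.*_) f) (0ℤ ∷ g) 0 ⟩
  coeff (map (b ℤ.*_) f) 0 ℤ.+ 0ℤ            ≡⟨ cong (ℤ._+ 0ℤ) (coeff-map-* b f 0) ⟩
  (a ℤ.* 0ℤ ℤ.+ 0ℤ) ℤ.* coeff f 0 ℤ.+ 0ℤ     ≡⟨ lemma a (coeff f 0) ⟩
  0ℤ                                         ∎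
  where
  open ≡-Reasoning
  -- `const a *ₚ X` computes to the unsimplified list `b ∷ a ℤ.* 1ℤ ∷ []`; `g` is the product of its
  -- tail with `f`.
  b = a ℤ.* 0ℤ ℤ.+ 0ℤ
  g = ((a ℤ.* 1ℤ) ∷ []) *ₚ f
  lemma : ∀ a x → (a ℤ.* 0ℤ ℤ.+ 0ℤ) ℤ.* x ℤ.+ 0ℤ ≡ 0ℤ
  lemma = solve-∀

coeff-aX*ₚ-suc : ∀ a f i → coeff (const a *ₚ X *ₚ f) (suc i) ≡ a ℤ.* coeff f i
coeff-aX*ₚ-suc a f i = begin
  coeff (map (b ℤ.*_) f +ₚ (0ℤ ∷ g)) (suc i)
    ≡⟨ coeff-+ₚ (map (b ℤ.*_) f) (0ℤ ∷ g) (suc i) ⟩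
  coeff (map (b ℤ.*_) f) (suc i) ℤ.+ coeff g i
    ≡⟨ cong₂ ℤ._+_ (coeff-map-* b f (suc i)) (coeff-+ₚ (map (a ℤ.* 1ℤ ℤ.*_) f) (0ℤ ∷ []) i) ⟩
  b ℤ.* coeff f (suc i) ℤ.+ (coeff (map (a ℤ.* 1ℤ ℤ.*_) f) i ℤ.+ coeff (0ℤ ∷ []) i)
    ≡⟨ cong₂ (λ x y → b ℤ.* coeff f (suc i) ℤ.+ (x ℤ.+ y)) (coeff-map-* (a ℤ.* 1ℤ) f i) (coeff-0∷[] i) ⟩
  b ℤ.* coeff f (suc i) ℤ.+ (a ℤ.* 1ℤ ℤ.* coeff f i ℤ.+ 0ℤ)
    ≡⟨ lemma a (coeff f (suc i)) (coeff f i) ⟩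
  a ℤ.* coeff f i ∎
  where
  open ≡-Reasoning
  b = a ℤ.* 0ℤ ℤ.+ 0ℤ
  g = ((a ℤ.* 1ℤ) ∷ []) *ₚ f
  lemma : ∀ a x y → (a ℤ.* 0ℤ ℤ.+ 0ℤ) ℤ.* x ℤ.+ (a ℤ.* 1ℤ ℤ.* y ℤ.+ 0ℤ) ≡ a ℤ.* y
  lemma = solve-∀

-- The recurrence and regularity of the coefficients.

module _ (c : Sequence) (c≡±1 : ∀ n → c n ≡ -1ℤ ⊎ c n ≡ 1ℤ) where

  c*[c*a]≡a : ∀ n a → c n ℤ.* (c n ℤ.* a) ≡ a
  c*[c*a]≡a n a with c n | c≡±1 n
  ... | _ | inj₁ refl = lemma a
    where
    lemma : ∀ a → -1ℤ ℤ.* (-1ℤ ℤ.* a) ≡ a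
    lemma = solve-∀
  ... | _ | inj₂ refl = lemma a
    where
    lemma : ∀ a → 1ℤ ℤ.* (1ℤ ℤ.* a) ≡ a
    lemma = solve-∀

  -- Since c² = 1, the two initial values of s can be absorbed into the
  -- sequence multiplied by c, and s is the sequence of its partial sums.
  partial-sums : ∀ s t → (∀ n → s (2 + n) ≡ s (1 + n) ℤ.+ c (2 + n) ℤ.* t n) →
    let d = c ⊙ cons (c 0 ℤ.* s 0) (cons (c 1 ℤ.* (s 1 - s 0)) t) in
    Σ< d ⊕ d ≗ s
  partial-sums s t h 0 = trans (ℤ.+-identityˡ _) (c*[c*a]≡a 0 (s 0))
  partial-sums s t h 1 = trans
    (cong₂ ℤ._+_ (partial-sums s t h 0) (c*[c*a]≡a 1 (s 1 - s 0))) (lemma (s 0) (s 1))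
    where
    lemma : ∀ x y → x ℤ.+ (y - x) ≡ y
    lemma = solve-∀
  partial-sums s t h (suc (suc n)) =
    trans (cong (ℤ._+ c (2 + n) ℤ.* t n) (partial-sums s t h (suc n))) (sym (h n))

  -- `Σ< d` stops before index `n`, so `Σ< d ⊕ d` is the inclusive sum; `d` is `c` times `t` with
  -- two terms prepended, which is regular.
  regular-recurrence : .{{_ : NonZero p}} → IsRegular p c → ∀ {s t} →
    (∀ n → s (2 + n) ≡ s (1 + n) ℤ.+ c (2 + n) ℤ.* t n) → IsRegular p t → IsRegular p s
  regular-recurrence reg-c {s} {t} h reg-t = regular-resp (partial-sums s t h) (regular-⊕ (regular-Σ< d) d)
    where d = regular-⊙ reg-c (regular-cons _ (regular-cons _ reg-t))

  regular-coeff : .{{_ : NonZero p}} → IsRegular p c → (F : ℕ → Poly) →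
    (∀ n → F (2 + n) ≈ₚ F (1 + n) +ₚ const (c (2 + n)) *ₚ X *ₚ F n) →
    ∀ i → IsRegular p (λ n → coeff (F n) i)
  -- The product with `x` has no constant term. Writing this zero as `c (2 + n) ℤ.* 0ℤ` fits the
  -- recurrence with `t = 0ₛ`.
  regular-coeff reg-c F rec zero = regular-recurrence reg-c
    (λ n → trans (rec n 0) (trans (coeff-+ₚ (F (1 + n)) _ 0) (cong (λ x → coeff (F (1 + n)) 0 ℤ.+ x)
      (trans (coeff-aX*ₚ-zero (c (2 + n)) (F n)) (sym (ℤ.*-zeroʳ (c (2 + n))))))))
    regular-0ₛ
  regular-coeff reg-c F rec (suc i) = regular-recurrence reg-c
    (λ n → trans (rec n (suc i)) (trans (coeff-+ₚ (F (1 + n)) _ (suc i))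
      (cong (λ x → coeff (F (1 + n)) (suc i) ℤ.+ x) (coeff-aX*ₚ-suc (c (2 + n)) (F n) i))))
    (regular-coeff reg-c F rec i)

proposition3p1 : (p : ℕ) → 2 ≤ p →
    (c : ℕ → ℤ) → (∀ n → c n ≡ -1ℤ ⊎ c n ≡ 1ℤ) →
    (F : ℕ → Poly) →
    (∀ n → F (2 + n) ≈ₚ F (1 + n) +ₚ const (c (2 + n)) *ₚ X *ₚ F n) →
    IsAutomatic p c →
    (i m : ℕ) → .{{_ : NonZero m}} → 2 ≤ m →
    IsAutomatic p (λ n → coeff (F n) i %ℕ m)
-- Matching `p` as a successor provides `NonZero p`; `2 ≤ p` rules out `zero`.
proposition3p1 (suc _) _ c c≡±1 F rec aut i m _ =
  regular⇒automatic-mod (regular-coeff c c≡±1 (automatic⇒regular aut) F rec i) m
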